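{- For every integer $n \geq 3$, $m(n) \geq n-1$, where $m(n)$ is the maximum sort-number (with respect to the map $SC_{231}$) among all permutations in $S_n$.
   Context: Permutations $p \in S_n$ are written in one-line notation as words $p(1)p(2)\cdots p(n)$. A permutation contains a pattern $\sigma\in S_k$ if it has a (not necessarily contiguous) subsequence of $k$ entries in the same relative order as $\sigma$; otherwise it avoids $\sigma$. A sequence of distinct numbers contains $\sigma$ consecutively if some $k$ contiguous entries are in the same relative order as $\sigma$. $\mathrm{Av}_n(132,231)$ is the set of permutations in $S_n$ avoiding both $132$ and $231$ (equivalently, permutations having no index $1<i<n$ with $p(i-1)<p(i)>p(i+1)$). The map $SC_{231}: S_n \to S_n$ is defined by passing $p$ through a stack: the entries of $p$ are the input, read left to right; the stack and output start empty. While the input is nonempty, let $x$ be the next input entry. If, after pushing $x$ on top of the stack, the stack contents read from top to bottom would not contain $231$ consecutively, then push $x$; otherwise pop the top entry of the stack and append it to the right end of the output (and repeat with the same $x$). When the input is empty, pop all remaining stack entries from top to bottom, appending each to the output. The resulting output word is $SC_{231}(p)$. For example $SC_{231}(45231)=13254$ and $SC_{231}(132)=321$. The sort-number of $p \in S_n$ is the minimum integer $k \geq 0$ such that $SC_{231}^k(p) \in \mathrm{Av}_n(132,231)$, where $SC_{231}^k$ is the $k$-fold iterate (such a $k$ exists for every $p$). -}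

module Defs where

open import Data.Bool.Base using (true; false; if_then_else_)
open import Data.Fin.Properties using (all?)
open import Data.List.Base using (List; []; _∷_; _++_; map; upTo)
open import Data.List.Properties using (++-identityʳ)
open import Data.List.Relation.Binary.Infix.Heterogeneous using (Infix; here; there)
open import Data.List.Relation.Binary.Permutation.Propositional using (_↭_; ↭-refl; ↭-sym; ↭-trans; ↭-reflexive; prep)
open import Data.List.Relation.Binary.Permutation.Propositional.Properties using (shift)
open import Data.List.Relation.Binary.Prefix.Heterogeneous using (Prefix; []; _∷_)
open import Data.List.Relation.Binary.Sublist.Propositional using (_⊆_)
open import Data.Nat.Base using (ℕ; zero; suc; _<_; _≤_)
open import Data.Nat.GeneralisedArithmetic using (iterate)
open import Data.Nat.Properties using (_<?_)
open import Data.Product.Base using (Σ-syntax; ∃-syntax; _×_; _,_; uncurry)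
open import Data.Sum.Base using (inj₁; inj₂; [_,_])
open import Data.Vec.Base using (Vec; []; _∷_; lookup; toList)
open import Function.Base using (_∘_)
open import Function.Bundles using (_⇔_; mk⇔; module Equivalence)
open import Relation.Binary.PropositionalEquality using (_≡_; refl)
open import Relation.Nullary.Decidable using (Dec; yes; no; does; map′; _×-dec_; _⊎-dec_; _→-dec_)
open import Relation.Nullary.Negation using (¬_)

Word : Set
Word = List ℕ

S : ℕ → Set
S n = Σ[ w ∈ Word ] w ↭ map suc (upTo n)

SameOrder : ∀ {k} → Vec ℕ k → Vec ℕ k → Set
SameOrder u σ = ∀ i j → lookup u i < lookup u j ⇔ lookup σ i < lookup σ j

Contains : ∀ {k} → Vec ℕ k → Word → Set
Contains {k} σ w = ∃[ u ] toList {n = k} u ⊆ w × SameOrder u σ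

ContainsConsecutively : ∀ {k} → Vec ℕ k → Word → Set
ContainsConsecutively {k} σ w = ∃[ u ] Infix _≡_ (toList {n = k} u) w × SameOrder u σ

[132] [231] : Vec ℕ 3
[132] = 1 ∷ 3 ∷ 2 ∷ []
[231] = 2 ∷ 3 ∷ 1 ∷ []

Av[132,231] : ∀ {n} → S n → Set
Av[132,231] (w , _) = ¬ Contains [132] w × ¬ Contains [231] w

sameOrder? : ∀ {k} (u σ : Vec ℕ k) → Dec (SameOrder u σ)
sameOrder? u σ = all? λ i → all? λ j →
  map′ (uncurry mk⇔) (λ e → Equivalence.to e , Equivalence.from e)
    ((lookup u i <? lookup u j →-dec lookup σ i <? lookup σ j) ×-dec
     (lookup σ i <? lookup σ j →-dec lookup u i <? lookup u j))

anyPrefix? : ∀ {k} {P : Vec ℕ k → Set} → (∀ u → Dec (P u)) →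
             ∀ w → Dec (∃[ u ] Prefix _≡_ (toList u) w × P u)
anyPrefix? {zero}  P? w =
  map′ (λ p → [] , [] , p) (λ { ([] , _ , p) → p }) (P? [])
anyPrefix? {suc k} P? [] = no λ { (_ ∷ _ , () , _) }
anyPrefix? {suc k} P? (x ∷ w) =
  map′ (λ { (u , pre , p) → x ∷ u , refl ∷ pre , p })
       (λ { (_ ∷ u , refl ∷ pre , p) → u , pre , p })
       (anyPrefix? (P? ∘ (x ∷_)) w)

anyInfix? : ∀ {k} {P : Vec ℕ k → Set} → (∀ u → Dec (P u)) →
            ∀ w → Dec (∃[ u ] Infix _≡_ (toList u) w × P u)
anyInfix? P? [] =
  map′ (λ { (u , pre , p) → u , here pre , p })
       (λ { (u , here pre , p) → u , pre , p })
       (anyPrefix? P? [])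
anyInfix? P? (x ∷ w) =
  map′ [ (λ { (u , pre , p) → u , here pre , p })
       , (λ { (u , inf , p) → u , there inf , p }) ]
       (λ { (u , here pre , p) → inj₁ (u , pre , p)
          ; (u , there inf , p) → inj₂ (u , inf , p) })
       (anyPrefix? P? (x ∷ w) ⊎-dec anyInfix? P? w)

containsConsecutively? : ∀ {k} (σ : Vec ℕ k) w → Dec (ContainsConsecutively σ w)
containsConsecutively? σ = anyInfix? λ u → sameOrder? u σ

-- `run231 input stack` is the word output from that state on; the head of
-- `stack` is its top.  Pushing onto the empty stack needs no test, since a
-- single entry cannot contain 231.
run231 : Word → Word → Word
run231 []       stack       = stack
run231 (x ∷ xs) []          = run231 xs (x ∷ [])
run231 (x ∷ xs) (t ∷ stack) =
  if does (containsConsecutively? [231] (x ∷ t ∷ stack))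
  then t ∷ run231 (x ∷ xs) stack
  else run231 xs (x ∷ t ∷ stack)

if-↭ : ∀ b {u v w : Word} → u ↭ w → v ↭ w → (if b then u else v) ↭ w
if-↭ true  u↭w _   = u↭w
if-↭ false _   v↭w = v↭w

run231-↭ : ∀ xs stack → run231 xs stack ↭ xs ++ stack
run231-↭ []       stack       = ↭-refl
run231-↭ (x ∷ xs) []          = ↭-trans (run231-↭ xs (x ∷ [])) (shift x xs [])
run231-↭ (x ∷ xs) (t ∷ stack) =
  if-↭ (does (containsConsecutively? [231] (x ∷ t ∷ stack)))
    (↭-trans (prep t (run231-↭ (x ∷ xs) stack)) (↭-sym (shift t (x ∷ xs) stack)))
    (↭-trans (run231-↭ xs (x ∷ t ∷ stack)) (shift x xs (t ∷ stack)))

SC231 : ∀ {n} → S n → S n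
SC231 (w , w↭) =
  run231 w [] ,
  ↭-trans (run231-↭ w []) (↭-trans (↭-reflexive (++-identityʳ w)) w↭)

IsMinimum IsMaximum : (ℕ → Set) → ℕ → Set
IsMinimum P k = P k × (∀ j → P j → k ≤ j)
IsMaximum P m = P m × (∀ j → P j → j ≤ m)

IsSortNumber : ∀ {n} → S n → ℕ → Set
IsSortNumber p = IsMinimum λ k → Av[132,231] (iterate SC231 p k)

-- "m(n) = m".  Minima and maxima are unique when they exist, so the sort-number
-- and m are represented by their graphs rather than as computed functions.
IsMaxSortNumber : ℕ → ℕ → Set
IsMaxSortNumber n = IsMaximum λ k → ∃[ p ] IsSortNumber {n} p k

{-# OPTIONS --safe #-}
module Submission where

-- Let d k = k, k-2, k-4, … and u k its reversal.  Whenever Z_k = u k · d (k-1) is surrounded by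
-- larger entries and k ≥ 3, a pass pops exactly k out of Z_k and reverses what remains, so that
-- Z_{k-1} appears, again surrounded by larger entries.  Since Z_k has a peak for k ≥ 3, and a pass
-- turns u (n-1) · d n into Z_n, the first n-1 iterates of that permutation all have peaks.
--
-- Its sort-number exists because every word is sorted eventually.  Keep a peakless block C of the
-- smallest entries, let a be the least entry outside C, and Y the entries between a and C.  A pass
-- reverses the order of C, Y, a and can only remove entries from Y; as Y lies between smaller
-- entries, two passes in a row remove at least one, so a eventually joins C.

open import Defs
open import Data.Empty using (⊥; ⊥-elim)
open import Data.Fin.Base using (zero; suc; opposite)
open import Data.List.Base using ([]; _∷_; [_]; _++_; _ʳ++_; length; map; reverse; upTo)
open import Data.List.Properties using (∷-injectiveˡ; ∷-injectiveʳ; ++-assoc; ++-cancelʳ; ++-identityʳ; length-++; length-reverse; map-++; reverse-++; reverse-involutive; upTo-∷ʳ; ʳ++-defn)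
open import Data.List.Relation.Binary.Infix.Heterogeneous using (Infix; here; there)
open import Data.List.Relation.Binary.Permutation.Propositional using (_↭_; ↭-refl; ↭-sym; ↭-trans; ↭-reflexive; prep; ↭⇒↭ₛ)
open import Data.List.Relation.Binary.Permutation.Propositional.Properties using (++-comm; ↭-length) renaming (++⁺ʳ to ++⁺ʳ-↭)
open import Data.List.Relation.Binary.Prefix.Heterogeneous using ([]; _∷_)
open import Data.List.Relation.Binary.Sublist.Propositional using (_⊆_; []; _∷_; _∷ʳ_; ⊆-refl; minimum)
open import Data.List.Relation.Binary.Sublist.Propositional.Properties as Sublist using (All-resp-⊆; ++⁺ˡ; ++⁺ʳ; reverse⁺)
open import Data.List.Relation.Unary.All as All using (All; []; _∷_)
open import Data.List.Relation.Unary.All.Properties as All using ()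
open import Data.List.Relation.Unary.AllPairs using ([]; _∷_)
open import Data.List.Relation.Unary.Unique.Propositional using (Unique)
open import Data.List.Relation.Unary.Unique.Propositional.Properties using (map⁺; upTo⁺)
open import Data.Nat.Base
open import Data.Nat.GeneralisedArithmetic using (iterate)
open import Data.Nat.Induction using (<-rec)
open import Data.Nat.Properties
open import Data.Product.Base using (_×_; _,_; ∃-syntax; ∃₂; proj₁; proj₂)
open import Data.Sum.Base using (_⊎_; inj₁; inj₂)
open import Data.Unit.Base using (⊤; tt)
open import Data.Vec.Base as Vec using (Vec; []; _∷_)
open import Function.Base using (_∘_)
open import Function.Bundles using (_⇔_; mk⇔; module Equivalence)
open import Relation.Binary.Definitions using (tri<; tri≈; tri>)
open import Relation.Binary.PropositionalEquality using (_≡_; _≢_; setoid; refl; sym; trans; cong; subst; module ≡-Reasoning)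
open import Relation.Nullary.Decidable using (Dec; yes; no; dec-true; dec-false; decidable-stable; _×-dec_)
open import Relation.Nullary.Negation using (¬_; contradiction)
open import Data.List.Relation.Binary.Permutation.Setoid.Properties (setoid ℕ) using (Unique-resp-↭)

-- The stack pass as a relation.

sc : Word → Word
sc w = run231 w []

-- The stack itself never contains a consecutive 231, so a new occurrence must consist of `x` and
-- the two topmost entries `t`, `s`; these have the order 231 exactly when `s < x < t`.
Pops : ℕ → Word → Set
Pops x (t ∷ s ∷ _) = s < x × x < t
Pops x _           = ⊥

pops? : ∀ x st → Dec (Pops x st)
pops? x []           = no λ ()
pops? x (t ∷ [])     = no λ ()
pops? x (t ∷ s ∷ st) = s <? x ×-dec x <? t

-- `Pass st xs out st′`: reading `xs` turns the stack `st` into `st′` and outputs `out`.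
data Pass : Word → Word → Word → Word → Set where
  end  : ∀ {st} → Pass st [] [] st
  push : ∀ {x xs st out st′} → ¬ Pops x st → Pass (x ∷ st) xs out st′ → Pass st (x ∷ xs) out st′
  pop  : ∀ {x xs t st out st′} → Pops x (t ∷ st) → Pass st (x ∷ xs) out st′ →
         Pass (t ∷ st) (x ∷ xs) (t ∷ out) st′

infixr 5 _▹_

_▹_ : ∀ {st st₁ st₂ xs ys out₁ out₂} →
      Pass st xs out₁ st₁ → Pass st₁ ys out₂ st₂ → Pass st (xs ++ ys) (out₁ ++ out₂) st₂
end      ▹ q = q
push n p ▹ q = push n (p ▹ q)
pop  y p ▹ q = pop y (p ▹ q)

sameOrder-231 : ∀ {x y z} → z < x → x < y → SameOrder (x ∷ y ∷ z ∷ []) [231]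
sameOrder-231 {x} {y} {z} z<x x<y = go
  where
  both : ∀ {P Q : Set} → P → Q → (P → Q) × (Q → P)
  both p q = (λ _ → q) , (λ _ → p)
  iff : ∀ {P Q : Set} → (P → Q) × (Q → P) → P ⇔ Q
  iff (f , g) = mk⇔ f g
  neither : ∀ {P Q : Set} → ¬ P → ¬ Q → (P → Q) × (Q → P)
  neither ¬p ¬q = (λ p → contradiction p ¬p) , (λ q → contradiction q ¬q)
  go : SameOrder (x ∷ y ∷ z ∷ []) [231]
  go zero             zero             = iff (neither (<-irrefl refl) (<-irrefl refl))
  go zero             (suc zero)       = iff (both x<y (n<1+n 2))
  go zero             (suc (suc zero)) = iff (neither (<-asym z<x) (<-asym (n<1+n 1)))
  go (suc zero)       zero             = iff (neither (<-asym x<y) (<-asym (n<1+n 2)))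
  go (suc zero)       (suc zero)       = iff (neither (<-irrefl refl) (<-irrefl refl))
  go (suc zero)       (suc (suc zero)) =
    iff (neither (<-asym (<-trans z<x x<y)) (<-asym (m<n+m 1 {2} (s≤s z≤n))))
  go (suc (suc zero)) zero             = iff (both z<x (n<1+n 1))
  go (suc (suc zero)) (suc zero)       = iff (both (<-trans z<x x<y) (m<n+m 1 {2} (s≤s z≤n)))
  go (suc (suc zero)) (suc (suc zero)) = iff (neither (<-irrefl refl) (<-irrefl refl))

Free : Word → Set
Free st = ¬ ContainsConsecutively [231] st

free-[] : Free []
free-[] (_ ∷ _ ∷ _ ∷ [] , here () , _)

free-tail : ∀ {t st} → Free (t ∷ st) → Free st
free-tail free (u , inf , so) = free (u , there inf , so)

free-push : ∀ {x st} → ¬ Pops x st → Free st → Free (x ∷ st)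
free-push ¬pops free (u , there inf , so) = free (u , inf , so)
free-push ¬pops free (_ ∷ _ ∷ _ ∷ [] , here (refl ∷ refl ∷ refl ∷ _) , so) =
  ¬pops ( Equivalence.from (so (suc (suc zero)) zero) (n<1+n 1)
        , Equivalence.from (so zero (suc zero)) (n<1+n 2))

pops-contains : ∀ {x t st} → Pops x (t ∷ st) → ContainsConsecutively [231] (x ∷ t ∷ st)
pops-contains {x} {t} {s ∷ st} (s<x , x<t) =
  x ∷ t ∷ s ∷ [] , here (refl ∷ refl ∷ refl ∷ []) , sameOrder-231 s<x x<t

-- Freeness of the stack is the invariant under which testing the whole stack agrees with the local
-- test `Pops`.
run231-pass : ∀ {st xs out st′} → Free st → Pass st xs out st′ → run231 xs st ≡ out ++ st′
run231-pass free end = refl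
run231-pass {[]}     free (push ¬pops p) = run231-pass (free-push ¬pops free) p
run231-pass {t ∷ st} {x ∷ xs} free (push ¬pops p)
  rewrite dec-false (containsConsecutively? [231] (x ∷ t ∷ st)) (free-push ¬pops free) =
  run231-pass (free-push ¬pops free) p
run231-pass {t ∷ st} {x ∷ xs} free (pop pops p)
  rewrite dec-true (containsConsecutively? [231] (x ∷ t ∷ st)) (pops-contains pops) =
  cong (t ∷_) (run231-pass (free-tail free) p)

sc-pass : ∀ {w out st} → Pass [] w out st → sc w ≡ out ++ st
sc-pass = run231-pass free-[]

-- Segments read above a protected part of the stack.

-- An entry exceeding the top of the stack `R` can never pop that top.
Floor : Word → Word → Set
Floor []      xs = ⊤
Floor (f ∷ _) xs = All (f <_) xs

floor-¬pops : ∀ {x R} → Floor R [ x ] → ¬ Pops x R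
floor-¬pops {R = f ∷ s ∷ _} (f<x ∷ []) (_ , x<f) = <-asym f<x x<f

floor-∷ : ∀ {x xs} R → Floor R (x ∷ xs) → Floor R [ x ] × Floor R xs
floor-∷ []      _            = tt , tt
floor-∷ (f ∷ R) (f<x ∷ f<xs) = (f<x ∷ []) , f<xs

-- Pops by `x` eat into `T` and stop at the latest when the top of `R` is exposed. The predicate
-- `P`, later `a <_`, keeps track of which entries can end up in the output and in the stack.
insert : ∀ {P : ℕ → Set} x T R → Floor R [ x ] → All P T →
         ∃₂ λ out D → Pass (T ++ R) [ x ] out (x ∷ D ++ R) × All P out × All P D
insert x []      R floor [] = [] , [] , push (floor-¬pops floor) end , [] , []
insert x (t ∷ T) R floor (pt ∷ pT) with pops? x (t ∷ T ++ R)
... | no ¬pops = [] , t ∷ T , push ¬pops end , [] , pt ∷ pT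
... | yes pops with insert x T R floor pT
...   | out , D , p , pout , pD = t ∷ out , D , pop pops p , pt ∷ pout , pD

scan : ∀ {P : ℕ → Set} xs T R → Floor R xs → All P xs → All P T →
       ∃₂ λ out D → Pass (T ++ R) xs out (D ++ R) × All P out × All P D
scan []       T R floor [] pT = [] , T , end , [] , pT
scan (x ∷ xs) T R floor (px ∷ pxs) pT with floor-∷ R floor
... | floor₁ , floor₂ with insert x T R floor₁ pT
...   | out₁ , D₁ , p₁ , pout₁ , pD₁ with scan xs (x ∷ D₁) R floor₂ pxs (px ∷ pD₁)
...     | out₂ , D₂ , p₂ , pout₂ , pD₂ = out₁ ++ out₂ , D₂ , p₁ ▹ p₂ , All.++⁺ pout₁ pout₂ , pD₂

scan-[] : ∀ {P : ℕ → Set} xs → All P xs →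
          ∃₂ λ out st → Pass [] xs out st × All P out × All P st
scan-[] xs pxs with scan xs [] [] tt pxs []
... | out , D , p , pout , pD = out , D , subst (Pass [] xs out) (++-identityʳ D) p , pout , pD

-- Passes that output nothing.

pass-length : ∀ {st xs out st′} → Pass st xs out st′ →
              length out + length st′ ≡ length xs + length st
pass-length end = refl
pass-length {st} {x ∷ xs} (push _ p) = trans (pass-length p) (+-suc (length xs) (length st))
pass-length {t ∷ st} {x ∷ xs} (pop _ p) =
  cong suc (trans (pass-length p) (sym (+-suc (length xs) (length st))))

pass-silent : ∀ {st xs st′} → Pass st xs [] st′ → st′ ≡ xs ʳ++ st
pass-silent end        = refl
pass-silent (push _ p) = pass-silent p

-- Every entry that is output is missing above `R`; if none is, all of `xs` has been pushed in order
-- and so lies reversed.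
pass-shrinks : ∀ {xs out} D R → Pass R xs out (D ++ R) →
               length D < length xs ⊎ out ≡ [] × D ≡ reverse xs
pass-shrinks {xs} {[]} D R p =
  inj₂ (refl , ++-cancelʳ R D (reverse xs) (trans (pass-silent p) (ʳ++-defn xs)))
pass-shrinks {xs} {o ∷ out} D R p =
  inj₁ (≤-trans (s≤s (m≤n+m (length D) (length out))) (≤-reflexive
    (+-cancelʳ-≡ (length R) (suc (length out + length D)) (length xs) (begin
      suc (length out + length D + length R)   ≡⟨ cong suc (+-assoc (length out) _ _) ⟩
      suc (length out + (length D + length R)) ≡⟨ cong (λ l → suc (length out + l)) (length-++ D) ⟨
      suc (length out + length (D ++ R))       ≡⟨ pass-length p ⟩
      length xs + length R                     ∎))))
  where open ≡-Reasoning

-- Both stacks are existentially quantified so that silence is inherited by suffixes, the dropped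
-- entries becoming part of the initial stack.
Silent : Word → Set
Silent xs = ∃₂ λ st st′ → Pass st xs [] st′

silent-tail : ∀ {x xs} → Silent (x ∷ xs) → Silent xs
silent-tail (_ , _ , push _ p) = _ , _ , p

silent-drop : ∀ xs {ys} → Silent (xs ++ ys) → Silent ys
silent-drop []       s = s
silent-drop (x ∷ xs) s = silent-drop xs (silent-tail s)

Consecutive : ℕ → ℕ → ℕ → Word → Set
Consecutive s t c = Infix _≡_ (s ∷ t ∷ c ∷ [])

-- When `c` is read, `t` and `s` are the two topmost entries, so a 132 would force a pop.
silent-start : ∀ {s t c xs} → Silent (s ∷ t ∷ c ∷ xs) → s < c → ¬ c < t
silent-start (_ , _ , push _ (push _ (push ¬pops _))) s<c c<t = ¬pops (s<c , c<t)

silent-¬132 : ∀ {s t c w} → Silent w → Consecutive s t c w → s < c → ¬ c < t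
silent-¬132 silent (here (refl ∷ refl ∷ refl ∷ _)) = silent-start silent
silent-¬132 silent (there inf)                     = silent-¬132 (silent-tail silent) inf

-- A consecutive 231 read backwards is a consecutive 132. The accumulator makes the induction on `w`
-- go through.
silent-¬231 : ∀ {s t c w acc} → Silent (w ʳ++ acc) → Consecutive s t c w → c < s → ¬ s < t
silent-¬231 {s} {t} {c} {_ ∷ _ ∷ _ ∷ w} {acc} silent (here (refl ∷ refl ∷ refl ∷ _)) =
  silent-start (silent-drop (reverse w) (subst Silent (ʳ++-defn w) silent))
silent-¬231 silent (there inf) = silent-¬231 silent inf

consecutive-distinct : ∀ {s t c w} → Unique w → Consecutive s t c w → s ≢ c
consecutive-distinct ((_ ∷ s≢c ∷ _) ∷ _) (here (refl ∷ refl ∷ refl ∷ _)) = s≢c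
consecutive-distinct (_ ∷ uniq)          (there inf) = consecutive-distinct uniq inf

-- As its two ends differ, a consecutive peak has the order 132 or 231; silence forwards excludes
-- the former, silence backwards the latter.
silent-¬peak : ∀ {s t c w} → Unique w → Silent w → Silent (reverse w) →
               Consecutive s t c w → s < t → ¬ c < t
silent-¬peak {s} {t} {c} uniq forth back inf s<t c<t with <-cmp s c
... | tri< s<c _ _ = silent-¬132 forth inf s<c c<t
... | tri≈ _ s≡c _ = consecutive-distinct uniq inf s≡c
... | tri> _ _ c<s = silent-¬231 back inf c<s s<t

-- The word starts with a rise and ends below all entries from `y` on, so it must descend somewhere;
-- the first descent completes a peak.
rise-fall-peak : ∀ {a x y} zs → x < y → All (a <_) (y ∷ zs) → Unique (y ∷ zs) →
                 (∀ {s t c} → Consecutive s t c (x ∷ y ∷ zs ++ [ a ]) → s < t → ¬ c < t) → ⊥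
rise-fall-peak [] x<y (a<y ∷ []) _ ¬peak = ¬peak (here (refl ∷ refl ∷ refl ∷ [])) x<y a<y
rise-fall-peak {y = y} (z ∷ zs) x<y (_ ∷ a<zs) ((y≢z ∷ _) ∷ uniq) ¬peak with <-cmp y z
... | tri< y<z _ _ = rise-fall-peak zs y<z a<zs uniq (¬peak ∘ there)
... | tri≈ _ y≡z _ = y≢z y≡z
... | tri> _ _ z<y = ¬peak (here (refl ∷ refl ∷ refl ∷ [])) x<y z<y

-- The step from the last entry of the low block to `y` is the rise that `rise-fall-peak` needs.
hill-peak : ∀ {a c y} C zs → All (_< a) (c ∷ C) → All (a <_) (y ∷ zs) → Unique (y ∷ zs) →
            (∀ {s t d} → Consecutive s t d (c ∷ C ++ (y ∷ zs) ++ [ a ]) → s < t → ¬ d < t) → ⊥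
hill-peak []      zs (c<a ∷ _) a<Y@(a<y ∷ _) uniq ¬peak =
  rise-fall-peak zs (<-trans c<a a<y) a<Y uniq ¬peak
hill-peak (d ∷ C) zs (_ ∷ C<a) a<Y uniq ¬peak = hill-peak C zs C<a a<Y uniq (¬peak ∘ there)

-- Words without peaks.

all-ʳ++ : ∀ {P : ℕ → Set} xs {ys} → All P xs → All P ys → All P (xs ʳ++ ys)
all-ʳ++ []       []         pys = pys
all-ʳ++ (x ∷ xs) (px ∷ pxs) pys = all-ʳ++ xs pxs (px ∷ pys)

NoPeak : Word → Set
NoPeak w = ∀ {x y z} → x ∷ y ∷ z ∷ [] ⊆ w → x < y → ¬ z < y

noPeak-reverse : ∀ {w} → NoPeak w → NoPeak (reverse w)
noPeak-reverse {w} np τ x<y z<y =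
  np (subst (_ ⊆_) (reverse-involutive w) (reverse⁺ τ)) z<y x<y

noPeak-∷ : ∀ {a w} → All (_< a) w → NoPeak w → NoPeak (a ∷ w)
noPeak-∷ w<a np (_ ∷ʳ τ)   x<y z<y = np τ x<y z<y
noPeak-∷ w<a np (refl ∷ τ) x<y z<y with All-resp-⊆ τ w<a
... | y<a ∷ _ = <-asym x<y y<a

noPeak-∷ʳ : ∀ {a w} → All (_< a) w → NoPeak w → NoPeak (w ++ [ a ])
noPeak-∷ʳ {a} {w} w<a np =
  subst NoPeak (trans (reverse-++ [ a ] (reverse w)) (cong (_++ [ a ]) (reverse-involutive w)))
    (noPeak-reverse (noPeak-∷ (all-ʳ++ w w<a []) (noPeak-reverse np)))

high-¬pops : ∀ {x st} → All (x ≤_) st → ¬ Pops x st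
high-¬pops {st = t ∷ s ∷ st} (_ ∷ x≤s ∷ _) (s<x , _) = <⇒≱ s<x x≤s

-- `T` is the part of the block already pushed. A pop by `c` needs `s < c < t` on top of the stack:
-- if both come from `T`, then `s t c` is a peak of the block; otherwise `s` comes from `L` and is
-- too large.
valley-pass : ∀ k T C L → NoPeak (T ʳ++ C) → All (_< k) T → All (_< k) C → All (k ≤_) L →
              Pass (T ++ L) C [] (C ʳ++ T ++ L)
valley-pass k T []      L np T<k C<k k≤L = end
valley-pass k T (c ∷ C) L np T<k (c<k ∷ C<k) k≤L =
  push (¬pops T L np T<k k≤L) (valley-pass k (c ∷ T) C L np (c<k ∷ T<k) C<k k≤L)
  where
  ¬pops : ∀ T L → NoPeak (T ʳ++ c ∷ C) → All (_< k) T → All (k ≤_) L → ¬ Pops c (T ++ L)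
  ¬pops []           L       np _ k≤L = high-¬pops (All.map (≤-trans (<⇒≤ c<k)) k≤L)
  ¬pops (t ∷ [])     (s ∷ L) np _ (k≤s ∷ _) (s<c , _) = <⇒≱ (<-trans s<c c<k) k≤s
  ¬pops (t ∷ s ∷ T)  L       np _ _ (s<c , c<t) =
    np (subst (_ ⊆_) (sym (ʳ++-defn T)) (++⁺ˡ (reverse T) (refl ∷ refl ∷ refl ∷ minimum C)))
      (<-trans s<c c<t) c<t

floor-ʳ++ : ∀ {a f} C L {B} → f < a → All (_< a) C → All (a ≤_) B → Floor (C ʳ++ f ∷ L) B
floor-ʳ++ []      L f<a C<a         a≤B = All.map (<-≤-trans f<a) a≤B
floor-ʳ++ (c ∷ C) L f<a (c<a ∷ C<a) a≤B = floor-ʳ++ C _ c<a C<a a≤B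

-- One pass around the block of smallest entries.

data Left (a : ℕ) (C Y : Word) : Word → Set where
  left : ∀ {X B} → All (a <_) X → All (a <_) Y → All (a <_) B → Left a C Y (X ++ a ∷ Y ++ C ++ B)

data Right (a : ℕ) (C Y : Word) : Word → Set where
  right : ∀ {A X} → All (a <_) A → All (a <_) Y → All (a <_) X → Right a C Y (A ++ C ++ Y ++ a ∷ X)

-- The block is nonempty by construction: its entry on top of the stack is the floor that protects
-- everything beneath from the larger entries read later.
data Centre (a : ℕ) : Word → Set where
  centre : ∀ {c C} → All (_< a) (c ∷ C) → NoPeak (c ∷ C) → Centre a (c ∷ C)

-- `a` is a floor for `Y`, and the pushed `C` is one for `B`, so only `Y` can lose entries;
-- unloading the stack from the top reverses the order of the three pieces. If `Y` loses nothing,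
-- the whole stretch from `a` through `C` is read silently.
leftStep : ∀ {a C Y w} → Centre a C → Left a C Y w →
           ∃[ D ] Right a (reverse C) D (sc w) ×
                  (length D < length Y ⊎ D ≡ reverse Y × Silent (a ∷ Y ++ C))
leftStep {a} {C} {Y} (centre {c} {C′} C<a np) (left {X} {B} a<X a<Y a<B)
  with scan-[] X a<X
... | o₁ , st , p₁ , a<o₁ , a<st
  with scan Y [] (a ∷ st) a<Y a<Y []
... | o₂ , D , p₂ , a<o₂ , a<D
  with scan B [] (C ʳ++ D ++ a ∷ st) (floor-ʳ++ C′ _ (All.head C<a) (All.tail C<a) (All.map <⇒≤ a<B)) a<B []
... | o₃ , E , p₃ , a<o₃ , a<E =
  D , subst (Right a (reverse C) D) (sym word) (right a<out a<D a<st) , shrink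
  where
  a-pass : Pass st [ a ] [] (a ∷ st)
  a-pass = push (high-¬pops (All.map <⇒≤ a<st)) end
  C-pass : Pass (D ++ a ∷ st) C [] (C ʳ++ D ++ a ∷ st)
  C-pass = valley-pass a [] C _ np [] C<a
    (All.++⁺ (All.map <⇒≤ a<D) (≤-refl ∷ All.map <⇒≤ a<st))
  a<out : All (a <_) ((o₁ ++ o₂ ++ o₃) ++ E)
  a<out = All.++⁺ (All.++⁺ a<o₁ (All.++⁺ a<o₂ a<o₃)) a<E
  word : sc (X ++ a ∷ Y ++ C ++ B) ≡ ((o₁ ++ o₂ ++ o₃) ++ E) ++ reverse C ++ D ++ a ∷ st
  word = trans (sc-pass (p₁ ▹ a-pass ▹ p₂ ▹ C-pass ▹ p₃))
    (trans (cong (λ u → (o₁ ++ o₂ ++ o₃) ++ E ++ u) (ʳ++-defn C))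
      (sym (++-assoc (o₁ ++ o₂ ++ o₃) E (reverse C ++ D ++ a ∷ st))))
  shrink : length D < length Y ⊎ D ≡ reverse Y × Silent (a ∷ Y ++ C)
  shrink with pass-shrinks D (a ∷ st) p₂
  ... | inj₁ D<Y          = inj₁ D<Y
  ... | inj₂ (refl , D≡Yʳ) = inj₂ (D≡Yʳ , _ , _ , a-pass ▹ p₂ ▹ C-pass)

rightStep : ∀ {a C Y w} → Centre a C → Right a C Y w →
            ∃[ D ] Left a (reverse C) D (sc w) ×
                   (length D < length Y ⊎ D ≡ reverse Y × Silent (C ++ Y ++ [ a ]))
rightStep {a} {C} {Y} (centre {c} {C′} C<a np) (right {A} {X} a<A a<Y a<X)
  with scan-[] A a<A
... | o₁ , st , p₁ , a<o₁ , a<st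
  with scan Y [] (C ʳ++ st) (floor-ʳ++ C′ st (All.head C<a) (All.tail C<a) (All.map <⇒≤ a<Y)) a<Y []
... | o₂ , D₀ , p₂ , a<o₂ , a<D₀
  with insert a D₀ (C ʳ++ st) (floor-ʳ++ C′ st (All.head C<a) (All.tail C<a) (≤-refl ∷ [])) a<D₀
... | o₃ , D , p₃ , a<o₃ , a<D
  with scan X [] (a ∷ D ++ C ʳ++ st) a<X a<X []
... | o₄ , E , p₄ , a<o₄ , a<E =
  D , subst (Left a (reverse C) D) (sym word) (left a<out a<D a<st) , shrink
  where
  C-pass : Pass st C [] (C ʳ++ st)
  C-pass = valley-pass a [] C _ np [] C<a (All.map <⇒≤ a<st)
  a<out : All (a <_) ((o₁ ++ o₂ ++ o₃ ++ o₄) ++ E)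
  a<out = All.++⁺ (All.++⁺ a<o₁ (All.++⁺ a<o₂ (All.++⁺ a<o₃ a<o₄))) a<E
  word : sc (A ++ C ++ Y ++ a ∷ X) ≡ ((o₁ ++ o₂ ++ o₃ ++ o₄) ++ E) ++ a ∷ D ++ reverse C ++ st
  word = trans (sc-pass (p₁ ▹ C-pass ▹ p₂ ▹ p₃ ▹ p₄))
    (trans (cong (λ u → (o₁ ++ o₂ ++ o₃ ++ o₄) ++ E ++ a ∷ D ++ u) (ʳ++-defn C))
      (sym (++-assoc (o₁ ++ o₂ ++ o₃ ++ o₄) E (a ∷ D ++ reverse C ++ st))))
  shrink : length D < length Y ⊎ D ≡ reverse Y × Silent (C ++ Y ++ [ a ])
  -- `a` may itself pop entries of `Y`, so the two are counted together. Abstracting `o₂ ++ o₃` lets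
  -- its emptiness be matched with `refl`.
  shrink with o₂ ++ o₃ | pass-shrinks {Y ++ [ a ]} (a ∷ D) (C ʳ++ st) (p₂ ▹ p₃) | p₂ ▹ p₃
  ... | _ | inj₁ D<Y         | _ =
    inj₁ (s≤s⁻¹ (≤-trans D<Y (≤-reflexive (trans (length-++ Y) (+-comm (length Y) 1)))))
  ... | _ | inj₂ (refl , eq) | p =
    inj₂ (∷-injectiveʳ (trans eq (reverse-++ Y [ a ])) , _ , _ , C-pass ▹ p)

-- Every word with distinct entries is sorted eventually.

unique-⊆ : ∀ {xs ys : Word} → xs ⊆ ys → Unique ys → Unique xs
unique-⊆ []          []           = []
unique-⊆ (_ ∷ʳ τ)    (_ ∷ uniq)   = unique-⊆ τ uniq
unique-⊆ (refl ∷ τ)  (x∉ ∷ uniq)  = All-resp-⊆ τ x∉ ∷ unique-⊆ τ uniq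

unique-↭ : ∀ {xs ys : Word} → xs ↭ ys → Unique xs → Unique ys
unique-↭ p = Unique-resp-↭ (↭⇒↭ₛ p)

sc-↭ : ∀ w → sc w ↭ w
sc-↭ w = ↭-trans (run231-↭ w []) (↭-reflexive (++-identityʳ w))

Distinct : ℕ → Word → Set
Distinct n w = Unique w × length w ≡ n

distinct-sc : ∀ {n w} → Distinct n w → Distinct n (sc w)
distinct-sc {w = w} (uniq , len) =
  unique-↭ (↭-sym (sc-↭ w)) uniq , trans (↭-length (sc-↭ w)) len

Sortable : Word → Set
Sortable w = ∃[ k ] NoPeak (iterate sc w k)

sortable-sc : ∀ {w} → Sortable (sc w) → Sortable w
sortable-sc (k , np) = suc k , np

-- The situation between two growth steps, when the next entry to join `C` has not been located.
data Hub (b : ℕ) (C : Word) : Word → Set where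
  hub : ∀ {A B} → All (b ≤_) A → All (b ≤_) B → Hub b C (A ++ C ++ B)

centre-reverse : ∀ {a C} → Centre a C → Centre a (reverse C)
-- The length equation rules out an empty reversal.
centre-reverse {C = C} (centre C<a np) with reverse C | all-ʳ++ C C<a [] | noPeak-reverse np | length-reverse C
... | c ∷ C′ | C′<a | np′ | _ = centre C′<a np′

centre-∷ʳ : ∀ {a C} → Centre a C → Centre (suc a) (C ++ [ a ])
centre-∷ʳ (centre C<a np) =
  centre (All.++⁺ (All.map m≤n⇒m≤1+n C<a) (≤-refl ∷ [])) (noPeak-∷ʳ C<a np)

-- Two passes without a pop exclude consecutive 132 and 231, hence every peak, from C · Y · a.
two-silent : ∀ {n a C y Y w} → Distinct n w → Centre a C → Right a C (y ∷ Y) w →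
             Silent (C ++ (y ∷ Y) ++ [ a ]) → ¬ Silent (a ∷ reverse (y ∷ Y) ++ reverse C)
two-silent {a = a} {C} {y} {Y} (uniq , _) (centre {c} {C′} C<a _) (right {A} {X} _ a<Y _) forth back =
  hill-peak C′ Y C<a a<Y (unique-⊆ (++⁺ˡ C (++⁺ʳ [ a ] ⊆-refl)) uniq-seg)
    (silent-¬peak uniq-seg forth (subst Silent (sym reversed) back))
  where
  uniq-seg : Unique (C ++ (y ∷ Y) ++ [ a ])
  uniq-seg = unique-⊆
    (++⁺ˡ A (Sublist.++⁺ (⊆-refl {x = C}) (Sublist.++⁺ (⊆-refl {x = y ∷ Y}) (refl ∷ minimum X)))) uniq
  reversed : reverse (C ++ (y ∷ Y) ++ [ a ]) ≡ a ∷ reverse (y ∷ Y) ++ reverse C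
  reversed = trans (reverse-++ C _) (cong (_++ reverse C) (reverse-++ (y ∷ Y) [ a ]))

-- `grow` is the hypothesis of an outer induction on the size of the block; inside the module the
-- number of entries between `a` and the block decreases.
module _ {n c a : ℕ}
         (grow : ∀ {C w} → Distinct n w → Centre (suc a) C → length C ≡ suc c → Hub (suc a) C w → Sortable w)
         where

  -- Induction on the bound `k`: of two successive passes one shortens `Y`, since both being silent
  -- contradicts `two-silent`. Once `Y` is empty, `a` is adjacent to `C` and joins it. From a `Left`
  -- position one pass leads here with the same bound.
  sortable-right : ∀ k {C Y w} → length Y ≤ k → Distinct n w → Centre a C → length C ≡ c →
                   Right a C Y w → Sortable w
  sortable-left  : ∀ k {C Y w} → length Y ≤ k → Distinct n w → Centre a C → length C ≡ c →
                   Left a C Y w → Sortable w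

  sortable-right k {C} {[]} _ dw ctr len (right {A} {X} a<A _ a<X) =
    grow dw (centre-∷ʳ ctr) (trans (length-++ C) (trans (+-comm (length C) 1) (cong suc len)))
      (subst (Hub (suc a) (C ++ [ a ])) (cong (A ++_) (++-assoc C [ a ] X)) (hub a<A a<X))
  sortable-right (suc k) {C} {y ∷ Y} Y≤k dw ctr len r with rightStep ctr r
  ... | D , l , inj₁ D<Y = sortable-sc (sortable-left k (s≤s⁻¹ (≤-trans D<Y Y≤k))
          (distinct-sc dw) (centre-reverse ctr) (trans (length-reverse C) len) l)
  ... | D , l , inj₂ (refl , silent) with leftStep (centre-reverse ctr) l
  ...   | D′ , r′ , inj₁ D′<D =
    sortable-sc (sortable-sc (sortable-right k
      (s≤s⁻¹ (≤-trans D′<D (≤-trans (≤-reflexive (length-reverse (y ∷ Y))) Y≤k)))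
      (distinct-sc (distinct-sc dw)) (centre-reverse (centre-reverse ctr))
      (trans (length-reverse (reverse C)) (trans (length-reverse C) len)) r′))
  ...   | D′ , r′ , inj₂ (_ , silent′) = contradiction silent′ (two-silent dw ctr r silent)
  sortable-left k {C} {Y} Y≤k dw ctr len l with leftStep ctr l
  ... | D , r , shrink = sortable-sc (sortable-right k (≤-trans (shorter shrink) Y≤k)
          (distinct-sc dw) (centre-reverse ctr) (trans (length-reverse C) len) r)
    where
    shorter : ∀ {D} {P : Set} → length D < length Y ⊎ D ≡ reverse Y × P → length D ≤ length Y
    shorter (inj₁ D<Y)        = <⇒≤ D<Y
    shorter (inj₂ (refl , _)) = ≤-reflexive (length-reverse Y)

minimum-split : ∀ xs → Unique xs →
                xs ≡ [] ⊎ ∃₂ λ P m → ∃[ Q ] xs ≡ P ++ m ∷ Q × All (m <_) P × All (m <_) Q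
minimum-split []       _ = inj₁ refl
minimum-split (x ∷ xs) (x∉ ∷ uniq) with minimum-split xs uniq
... | inj₁ refl = inj₂ ([] , x , [] , refl , [] , [])
... | inj₂ (P , m , Q , refl , m<P , m<Q) with <-cmp x m
...   | tri< x<m _ _ = inj₂ ([] , x , P ++ m ∷ Q , refl , [] ,
                          All.++⁺ (All.map (<-trans x<m) m<P) (x<m ∷ All.map (<-trans x<m) m<Q))
...   | tri≈ _ x≡m _ = contradiction x≡m (All.head (All.++⁻ʳ P x∉))
...   | tri> _ _ m<x = inj₂ (x ∷ P , m , Q , refl , m<x ∷ m<P , m<Q)

++-split : ∀ A {B : Word} P {m Q} → A ++ B ≡ P ++ m ∷ Q →
           (∃[ Y ] A ≡ P ++ m ∷ Y × Q ≡ Y ++ B) ⊎ (∃[ X ] B ≡ X ++ m ∷ Q × P ≡ A ++ X)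
++-split []      P       eq   = inj₂ (P , eq , refl)
++-split (x ∷ A) []      refl = inj₁ (A , refl , refl)
++-split (x ∷ A) (y ∷ P) eq with ∷-injectiveˡ eq | ++-split A P (∷-injectiveʳ eq)
... | refl | inj₁ (Y , refl , refl) = inj₁ (Y , refl , refl)
... | refl | inj₂ (X , refl , refl) = inj₂ (X , refl , refl)

centre-mono : ∀ {a b C} → a ≤ b → Centre a C → Centre b C
centre-mono a≤b (centre C<a np) = centre (All.map (λ c<a → <-≤-trans c<a a≤b) C<a) np

-- Induction on `m`, which exceeds the number of entries outside `C`. The least of these takes the
-- role of `a`, to the left or to the right of `C`.
sortable-hub : ∀ {n b C w} m → n < length C + m → Distinct n w → Centre b C → Hub b C w → Sortable w

sortable-grown : ∀ {n c b C w} m → n < c + suc m → Distinct n w → Centre b C → length C ≡ suc c →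
                 Hub b C w → Sortable w
sortable-grown {c = c} m n<c+m dw ctr len =
  sortable-hub m (≤-trans n<c+m (≤-reflexive (trans (+-suc c m) (cong (_+ m) (sym len))))) dw ctr

sortable-hub {n} {C = C} zero n<C (_ , len) ctr (hub {A} {B} _ _) = contradiction n<C (≤⇒≯ (begin
  length C + 0            ≡⟨ +-identityʳ (length C) ⟩
  length C                ≤⟨ m≤m+n (length C) (length B) ⟩
  length C + length B     ≡⟨ length-++ C ⟨
  length (C ++ B)         ≤⟨ m≤n+m (length (C ++ B)) (length A) ⟩
  length A + length (C ++ B) ≡⟨ length-++ A ⟨
  length (A ++ C ++ B)    ≡⟨ len ⟩
  n                       ∎))
  where open ≤-Reasoning
sortable-hub {n} {b} {C} (suc m) n<C+m (uniq , len) ctr (hub {A} {B} b≤A b≤B)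
  with minimum-split (A ++ B) (unique-⊆ (Sublist.++⁺ (⊆-refl {x = A}) (++⁺ˡ C ⊆-refl)) uniq)
... | inj₁ eq with A | B
...   | [] | [] = 0 , subst NoPeak (sym (++-identityʳ C)) (noPeak ctr)
  where
  noPeak : ∀ {a C} → Centre a C → NoPeak C
  noPeak (centre _ np) = np
sortable-hub {n} {b} {C} (suc m) n<C+m (uniq , len) ctr (hub {A} {B} b≤A b≤B)
    | inj₂ (P , a , Q , eq , a<P , a<Q) with ++-split A P eq
... | inj₁ (Y , refl , refl) =
  sortable-left (sortable-grown m n<C+m) (length Y) ≤-refl (uniq , len)
    (centre-mono (All.head (All.++⁻ʳ P b≤A)) ctr) refl
    (subst (Left a C Y) (sym (++-assoc P (a ∷ Y) (C ++ B)))
      (left a<P (All.++⁻ˡ Y a<Q) (All.++⁻ʳ Y a<Q)))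
... | inj₂ (X , refl , refl) =
  sortable-right (sortable-grown m n<C+m) (length X) ≤-refl (uniq , len)
    (centre-mono (All.head (All.++⁻ʳ X b≤B)) ctr) refl
    (right (All.++⁻ˡ A a<P) (All.++⁻ʳ A a<P) a<Q)

sortable : ∀ w → Unique w → Sortable w
sortable w uniq with minimum-split w uniq
... | inj₁ refl = 0 , λ ()
... | inj₂ (P , m , Q , refl , m<P , m<Q) =
  -- The first block is the least entry alone, with `b = suc m`.
  sortable-hub (length w) ≤-refl (uniq , refl)
    (centre (n<1+n m ∷ []) λ { (_ ∷ʳ ()) ; (_ ∷ ()) }) (hub m<P m<Q)

-- The words `d k` and `u k`, and the zigzag blocks Z_k.

down : ℕ → Word
down zero          = []
down (suc zero)    = [ 1 ]
down (suc (suc k)) = suc (suc k) ∷ down k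

up : ℕ → Word
up zero          = []
up (suc zero)    = [ 1 ]
up (suc (suc k)) = up k ++ [ suc (suc k) ]

down-suc : ∀ k → ∃[ D ] down (suc k) ≡ suc k ∷ D
down-suc zero    = [] , refl
down-suc (suc k) = down k , refl

low-¬pops : ∀ {x t} st → t ≤ x → ¬ Pops x (t ∷ st)
low-¬pops (s ∷ st) t≤x (_ , x<t) = <⇒≱ x<t t≤x

down-¬pops : ∀ k {x} L → k ≤ x → All (x ≤_) L → ¬ Pops x (down k ++ L)
down-¬pops zero          L k≤x x≤L = high-¬pops x≤L
down-¬pops (suc zero)    L k≤x _   = low-¬pops L k≤x
down-¬pops (suc (suc k)) L k≤x _   = low-¬pops (down k ++ L) k≤x

up-pass : ∀ k L → All (k ≤_) L → Pass L (up k) [] (down k ++ L)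
up-pass zero          L k≤L = end
up-pass (suc zero)    L k≤L = push (high-¬pops k≤L) end
up-pass (suc (suc k)) L k≤L =
  up-pass k L (All.map (≤-trans (m≤n+m k 2)) k≤L) ▹ push (down-¬pops k L (m≤n+m k 2) k≤L) end

-- A pop requires a second stack entry below the entry being read; here the second one is always at
-- least as large.
down-pass : ∀ k {t s} L → k ≤ t → k ≤ s → Pass (t ∷ s ∷ L) (down k) [] (up k ++ t ∷ s ∷ L)
down-pass zero          L k≤t k≤s = end
down-pass (suc zero)    L k≤t k≤s = push (λ (s<1 , _) → <⇒≱ s<1 k≤s) end
down-pass (suc (suc k)) L k≤t k≤s =
  push (λ (s<k , _) → <⇒≱ s<k k≤s)
    (subst (Pass _ (down k) []) (sym (++-assoc (up k) [ 2 + k ] _))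
      (down-pass k _ (m≤n+m k 2) (≤-trans (m≤n+m k 2) k≤t)))

peak-pops : ∀ k L → Pops (2 + k) (3 + k ∷ down (1 + k) ++ L)
peak-pops k L with down (1 + k) | down-suc k
... | _ | D , refl = n<1+n (1 + k) , n<1+n (2 + k)

floor-up : ∀ k R {xs} → All (1 + k <_) xs → Floor (up (1 + k) ++ R) xs
floor-up zero          R k<xs = k<xs
floor-up (suc zero)    R k<xs = k<xs
floor-up (suc (suc k)) R k<xs =
  subst (λ u → Floor u _) (sym (++-assoc (up (1 + k)) [ 3 + k ] R))
    (floor-up k (3 + k ∷ R) (All.map (≤-trans (m≤n+m (2 + k) 2)) k<xs))

-- `up (3 + k)` lies on the stack as `down (3 + k)`. Then `2 + k` pops `3 + k`, because `1 + k` lies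
-- beneath, and settles on `down (1 + k)`; the remaining `down k` is pushed silently and completes
-- `up (2 + k)`.
zigzag-pass : ∀ k L → All (3 + k ≤_) L →
              Pass L (up (3 + k) ++ down (2 + k)) [ 3 + k ] (up (2 + k) ++ down (1 + k) ++ L)
zigzag-pass k L k≤L =
  up-pass (3 + k) L k≤L ▹ pop (peak-pops k L)
    (push (down-¬pops (1 + k) L (n≤1+n (1 + k)) (All.map (≤-trans (n≤1+n (2 + k))) k≤L)) rest)
  where
  rest : Pass (2 + k ∷ down (1 + k) ++ L) (down k) [] (up (2 + k) ++ down (1 + k) ++ L)
  rest with down (1 + k) | down-suc k
  ... | _ | D , refl = subst (Pass _ (down k) []) (sym (++-assoc (up k) [ 2 + k ] _))
                         (down-pass k (D ++ L) (m≤n+m k 2) (m≤n+m k 1))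

-- The index is shifted: the block inside is Z_(k+1).
data Zigzag (k : ℕ) : Word → Set where
  zigzag : ∀ {A B} → All (1 + k <_) A → All (1 + k <_) B →
           Zigzag k (A ++ up (1 + k) ++ down k ++ B)

zigzag-sc : ∀ k {w} → Zigzag (2 + k) w → Zigzag (1 + k) (sc w)
zigzag-sc k (zigzag {A} {B} k<A k<B)
  with scan-[] A k<A
... | o₁ , st , p₁ , k<o₁ , k<st
  with scan B [] (up (2 + k) ++ down (1 + k) ++ st)
         (floor-up (1 + k) _ (All.map (≤-trans (n≤1+n (3 + k))) k<B)) k<B []
... | o₂ , E , p₂ , k<o₂ , k<E =
  subst (Zigzag (1 + k)) (sym word)
    -- The popped entry `3 + k` joins the larger entries on the left; `≤-refl` is its bound.
    (zigzag (All.++⁺ (All.++⁺ (weaken k<o₁) (≤-refl ∷ weaken k<o₂)) (weaken k<E)) (weaken k<st))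
  where
  weaken : ∀ {xs} → All (3 + k <_) xs → All (2 + k <_) xs
  weaken = All.map (≤-trans (n≤1+n (3 + k)))
  core : Word
  core = up (2 + k) ++ down (1 + k) ++ st
  word : sc (A ++ up (3 + k) ++ down (2 + k) ++ B) ≡ ((o₁ ++ 3 + k ∷ o₂) ++ E) ++ core
  word = trans (cong (λ u → sc (A ++ u)) (sym (++-assoc (up (3 + k)) (down (2 + k)) B)))
    (trans (sc-pass (p₁ ▹ zigzag-pass k st (All.map <⇒≤ k<st) ▹ p₂))
      (sym (++-assoc (o₁ ++ 3 + k ∷ o₂) E core)))

end-⊆-up : ∀ k → [ 1 + k ] ⊆ up (1 + k)
end-⊆-up zero    = ⊆-refl
end-⊆-up (suc k) = ++⁺ˡ (up k) ⊆-refl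

start-⊆-down : ∀ k → [ 1 + k ] ⊆ down (1 + k)
start-⊆-down k with down (1 + k) | down-suc k
... | _ | D , refl = refl ∷ minimum D

zigzag-peak : ∀ k {w} → Zigzag (2 + k) w → ¬ NoPeak w
zigzag-peak k (zigzag {A} {B} _ _) np =
  -- The peak is `1 + k`, `3 + k`, `2 + k`, where `up` meets `down`.
  np (++⁺ˡ A (Sublist.++⁺ (Sublist.++⁺ (end-⊆-up k) ⊆-refl) (refl ∷ minimum _)))
    (m≤n+m (2 + k) 1) (n<1+n (2 + k))

-- After j passes with j at most k the block is Z_(k+3-j), whose index is still at least 3.
zigzag-slow : ∀ k i {w} → Zigzag (2 + k) w → NoPeak (iterate sc w i) → k < i
zigzag-slow k       zero    z np = ⊥-elim (zigzag-peak k z np)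
zigzag-slow zero    (suc i) z np = s≤s z≤n
zigzag-slow (suc k) (suc i) z np = s≤s (zigzag-slow k i (zigzag-sc (suc k) z) np)

slow : ℕ → Word
slow k = up (2 + k) ++ down (3 + k)

-- Nothing is popped before the input ends, so the pass reverses `slow k`; with n = k + 3 this turns
-- `u (n-1) · d n` into Z_n, with nothing around it.
slow-sc : ∀ k → Zigzag (2 + k) (sc (slow k))
slow-sc k = subst (Zigzag (2 + k)) (sym word) (zigzag [] [])
  where
  word : sc (slow k) ≡ up (3 + k) ++ down (2 + k) ++ []
  word = trans
    (sc-pass (up-pass (2 + k) [] [] ▹ push (low-¬pops (down k ++ []) (n≤1+n (2 + k)))
      (down-pass (1 + k) (down k ++ []) (m≤n+m (1 + k) 2) (n≤1+n (1 + k)))))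
    (sym (++-assoc (up (1 + k)) [ 3 + k ] _))

slow-peak : ∀ k → ¬ NoPeak (slow k)
slow-peak k np =
  np (Sublist.++⁺ (end-⊆-up (1 + k)) (refl ∷ start-⊆-down k)) (n<1+n (2 + k)) (m≤n+m (2 + k) 1)

slow-bound : ∀ k i → NoPeak (iterate sc (slow k) i) → 2 + k ≤ i
slow-bound k zero    np = ⊥-elim (slow-peak k np)
slow-bound k (suc i) np = s≤s (zigzag-slow k i (slow-sc k) np)

-- From words to permutations and patterns, and the bound.

up-↭-down : ∀ k → up k ↭ down k
up-↭-down zero          = ↭-refl
up-↭-down (suc zero)    = ↭-refl
up-↭-down (suc (suc k)) = ↭-trans (++-comm (up k) [ 2 + k ]) (prep (2 + k) (up-↭-down k))

-- The two words are the two parity classes of the numbers from 1 to `1 + k`.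
down-down-↭ : ∀ k → down k ++ down (1 + k) ↭ map suc (upTo (1 + k))
down-down-↭ zero    = ↭-refl
down-down-↭ (suc k) = ↭-trans (++-comm (down (1 + k)) (down (2 + k)))
  (↭-trans (prep (2 + k) (down-down-↭ k))
    (↭-trans (++-comm [ 2 + k ] (map suc (upTo (1 + k)))) (↭-reflexive last)))
  where
  last : map suc (upTo (1 + k)) ++ [ 2 + k ] ≡ map suc (upTo (2 + k))
  last = trans (sym (map-++ suc (upTo (1 + k)) [ 1 + k ])) (cong (map suc) (upTo-∷ʳ (1 + k)))

slowPermutation : ∀ k → S (3 + k)
slowPermutation k =
  slow k , ↭-trans (++⁺ʳ-↭ (down (3 + k)) (up-↭-down (2 + k))) (down-down-↭ (2 + k))

iterate-SC231 : ∀ {n} (p : S n) k → proj₁ (iterate SC231 p k) ≡ iterate sc (proj₁ p) k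
iterate-SC231 p zero    = refl
iterate-SC231 p (suc k) = iterate-SC231 (SC231 p) k

unique-S : ∀ {n} (p : S n) → Unique (proj₁ p)
unique-S {n} (_ , w↭) = unique-↭ (↭-sym w↭) (map⁺ suc-injective (upTo⁺ n))

lookup-mirror : ∀ (x y z : ℕ) i → Vec.lookup (x ∷ y ∷ z ∷ []) i ≡ Vec.lookup (z ∷ y ∷ x ∷ []) (opposite i)
lookup-mirror x y z zero             = refl
lookup-mirror x y z (suc zero)       = refl
lookup-mirror x y z (suc (suc zero)) = refl

-- 132 is the reversal of 231, so both positions are mirrored by `opposite`.
sameOrder-132 : ∀ {x y z} → x < z → z < y → SameOrder (x ∷ y ∷ z ∷ []) [132]
sameOrder-132 {x} {y} {z} x<z z<y i j
  rewrite lookup-mirror x y z i | lookup-mirror x y z j | lookup-mirror 1 3 2 i | lookup-mirror 1 3 2 j =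
  sameOrder-231 x<z z<y (opposite i) (opposite j)

av⇒noPeak : ∀ {n} (p : S n) → Av[132,231] p → NoPeak (proj₁ p)
av⇒noPeak p (¬132 , ¬231) {x} {y} {z} τ x<y z<y with <-cmp x z
... | tri< x<z _ _ = ¬132 (x ∷ y ∷ z ∷ [] , τ , sameOrder-132 x<z z<y)
... | tri> _ _ z<x = ¬231 (x ∷ y ∷ z ∷ [] , τ , sameOrder-231 z<x x<y)
... | tri≈ _ x≡z _ with unique-⊆ τ (unique-S p)
...   | (_ ∷ x≢z ∷ []) ∷ _ = x≢z x≡z

noPeak⇒av : ∀ {n} (p : S n) → NoPeak (proj₁ p) → Av[132,231] p
noPeak⇒av p np =
  (λ { (x ∷ y ∷ z ∷ [] , τ , so) →
       np τ (Equivalence.from (so zero (suc zero)) (m<n+m 1 {2} (s≤s z≤n)))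
            (Equivalence.from (so (suc (suc zero)) (suc zero)) (n<1+n 2)) }) ,
  (λ { (x ∷ y ∷ z ∷ [] , τ , so) →
       np τ (Equivalence.from (so zero (suc zero)) (n<1+n 2))
            (Equivalence.from (so (suc (suc zero)) (suc zero)) (m<n+m 1 {2} (s≤s z≤n))) })

-- `P` is not assumed decidable, so the minimum is obtained under a double negation only; that
-- suffices for proving a decidable inequality.
¬¬-minimum : ∀ {P : ℕ → Set} k → P k → ¬ ¬ (∃[ j ] IsMinimum P j)
¬¬-minimum {P} k Pk ¬min = <-rec (λ j → ¬ P j)
  (λ j ¬smaller Pj → ¬min (j , Pj , λ i Pi → ≮⇒≥ λ i<j → ¬smaller i<j Pi)) k Pk

theorem4p2 : ∀ (n m : ℕ) → 3 ≤ n → IsMaxSortNumber n m → n ∸ 1 ≤ m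
theorem4p2 (suc (suc (suc k))) m (s≤s (s≤s (s≤s _))) (_ , maximal) =
  decidable-stable (2 + k ≤? m) λ ¬bound →
    ¬¬-minimum i (noPeak⇒av (iterate SC231 p i) (subst NoPeak (sym (iterate-SC231 p i)) np))
      -- `j` is the sort-number of `p`: at least `2 + k` by `slow-bound`, at most `m` by maximality.
      λ (j , av , least) → ¬bound (≤-trans
        (slow-bound k j (subst NoPeak (iterate-SC231 p j) (av⇒noPeak (iterate SC231 p j) av)))
        (maximal j (p , av , least)))
  where
  p : S (3 + k)
  p = slowPermutation k
  i : ℕ
  i = proj₁ (sortable (slow k) (unique-S p))
  np : NoPeak (iterate sc (slow k) i)
  np = proj₂ (sortable (slow k) (unique-S p))
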